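{- Let $m\ge 4$ be even, let $\tilde M=(\tilde m_{i,j})_{i,j\in[0,m-1]}$ be a magic square of side $m$ with magic constant $\tilde\mu$, and let $Q$ be the $2m\times 2m$ square over $D_{2m^2}$ built from $\tilde M$ with blocks $Q^{11},Q^{12},Q^{21},Q^{22}$ as described in the context. Then for all $i,j,c\in[0,m-1]$ the following hold. Row products: $$\rho^{11}_{i,0}\,\rho^{12}_{i,c}=\rho^{21}_{i,c}\,\rho^{22}_{i,0}=\begin{cases} r^{4\tilde\mu}, & c \text{ even},\\ r^{m}, & c\text{ odd};\end{cases}$$ column products: $$\sigma^{11}_{j,0}\,\sigma^{21}_{j,c}=\sigma^{12}_{j,c}\,\sigma^{22}_{j,0}=\begin{cases} r^{4\tilde\mu}, & c \text{ even},\\ r^{m}, & c\text{ odd}.\end{cases}$$ Consequently the single $D_{2m^2}$-semi-magic square $Q$ admits two distinct magic constants, $r^{4\tilde\mu}$ and $r^{m}$, depending on the order in which the products are taken.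
   Context: $[a,b]$ denotes the set of integers from $a$ to $b$. The dihedral group $D_k$ ($k\ge3$) has order $2k$ and elements $r^i$ (rotations) and $r^is$ (reflections), $0\le i\le k-1$, with $r^k=e$, $(r^is)^2=e$, $r^is=sr^{ -i}$. A magic square of side $m$ is an $m\times m$ array containing each of $1,2,\dots,m^2$ exactly once such that every row, every column and both main diagonals have the same sum $\tilde\mu=m(m^2+1)/2$ (the magic constant). For a group $\Gamma$ of order $n^2$, a $\Gamma$-semi-magic square of side $n$ with magic constant $\mu\in\Gamma$ is an $n\times n$ array containing each element of $\Gamma$ exactly once such that for every row, and for every column, there is an ordering of its entries in which their product equals $\mu$. An element $\mu$ for which this holds is called a magic constant of the array; an array may have more than one. Construction of $Q$ for $m$ even. All row and column indices $i,j$ range over $[0,m-1]$ and are read modulo $m$; exponents of $r$ are read modulo $2m^2$. Put $e_{i,j}=2\tilde m_{i,j}$, $o_{i,j}=2\tilde m_{i,j}+1$, $t_{i,j}=-2\tilde m_{i,j}+1$ (all modulo $2m^2$). Define $m\times m$ arrays $Q^{uv}=(q^{uv}_{i,j})$, $u,v\in\{1,2\}$, by - $q^{11}_{i,j}=r^{e_{i,j}}$ if $i+j$ is even, and $r^{o_{i,j}}$ if $i+j$ is odd; - $q^{22}_{i,j}=r^{e_{i,j+1}}$ if $i+j$ is even, and $r^{o_{i,j+1}}$ if $i+j$ is odd; - $q^{12}_{i,j}=r^{e_{i,j}}s$ if $i+j$ is even, and $r^{t_{i,j}}s$ if $i+j$ is odd; - $q^{21}_{i,j}=r^{e_{i,j+1}}s$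 if $i+j$ is even, and $r^{t_{i,j+1}}s$ if $i+j$ is odd. The square $Q$ is the $2m\times 2m$ block array with $Q^{11}$ top left, $Q^{12}$ top right, $Q^{21}$ bottom left, $Q^{22}$ bottom right. For $c\in[0,m-1]$, define the products of all $m$ entries of a row or column of a block, taken in cyclic order (subscripts modulo $m$): $$\rho^{uv}_{i,c}=q^{uv}_{i,i+c}\,q^{uv}_{i,i+c+1}\cdots q^{uv}_{i,i+c-1},\qquad \sigma^{uv}_{j,c}=q^{uv}_{j-c,j}\,q^{uv}_{j-c-1,j}\cdots q^{uv}_{j-c+1,j}.$$ -}

module Defs where

open import Algebra.Bundles using (Group)
open import Algebra.Structures using (IsGroup)
import Algebra.Definitions.RawMonoid as RawMonoidSum
open import Data.Bool.Base using (if_then_else_)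
open import Data.Fin.Base using (Fin; toℕ; fromℕ<; opposite; remQuot)
open import Data.Fin.Patterns using (0F; 1F)
open import Data.Fin.Permutation using (Permutation′; _⟨$⟩ʳ_)
open import Data.Fin.Properties using (toℕ<n; toℕ-fromℕ<; toℕ-injective)
open import Data.Integer.Base as ℤ using (ℤ; +_; 0ℤ; 1ℤ; _%ℕ_; _/ℕ_)
open import Data.Integer.Divisibility.Signed as ℤ∣ using (divides)
open import Data.Integer.DivMod using (n%ℕd<d; a≡a%ℕn+[a/ℕn]*n)
import Data.Integer.Properties as ℤₚ
open import Data.Integer.Tactic.RingSolver using (solve-∀)
open import Data.Nat.Base using (ℕ; zero; suc; _⊔_; _≤_; _<_; NonZero; _+_; _*_; _^_; _/_; +-0-rawMonoid)
open import Data.Nat.Divisibility using (_∣?_; >⇒∤)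
open import Data.Nat.Properties using (m*n≢0; m^n≢0; ≤-<-trans; ⊔-pres-<m)
open import Data.Product using (_×_; _,_; ∃!; Σ-syntax)
open import Level as Level using (0ℓ)
open import Relation.Binary.PropositionalEquality
open import Relation.Nullary.Decidable using (⌊_⌋)
open import Relation.Nullary.Negation using (contradiction)

infixl 7 _modℤ_

_modℤ_ : ℤ → (k : ℕ) → .{{NonZero k}} → Fin k
z modℤ k = fromℕ< (n%ℕd<d z k)

ι : ∀ {k} → Fin k → ℤ
ι i = + toℕ i

ifEven_then_else_ : ∀ {a} {A : Set a} → ℕ → A → A → A
ifEven n then x else y = if ⌊ 2 ∣? n ⌋ then x else y

------------------------------------------------------------------------
-- Arithmetic modulo k

module _ {k : ℕ} .{{_ : NonZero k}} where

  private
    bounded : ∀ a b → a < k → b < k → + k ℤ∣.∣ + a ℤ.- + b → a ≡ b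
    bounded a b a<k b<k d with ℤ.∣ + a ℤ.- + b ∣ in eq | ℤ∣.∣⇒∣ᵤ d
    ... | zero  | _ = ℤₚ.+-injective (ℤₚ.i-j≡0⇒i≡j (+ a) (+ b) (ℤₚ.∣i∣≡0⇒i≡0 eq))
    ... | suc n | e = contradiction e (>⇒∤ (subst (_< k) eq small))
      where
      small : ℤ.∣ + a ℤ.- + b ∣ < k
      small = ≤-<-trans
        (subst (λ z → ℤ.∣ z ∣ ≤ a ⊔ b) (sym (ℤₚ.m-n≡m⊖n a b)) (ℤₚ.∣m⊝n∣≤m⊔n a b))
        (⊔-pres-<m a<k b<k)

    mod-diff : ∀ x → + k ℤ∣.∣ x ℤ.- + (x %ℕ k)
    mod-diff x = divides (x /ℕ k) (begin
      x ℤ.- r                ≡⟨ cong (ℤ._- r) (a≡a%ℕn+[a/ℕn]*n x k) ⟩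
      r ℤ.+ q ℤ.- r          ≡⟨ cancel r q ⟩
      q                      ∎)
      where
      open ≡-Reasoning
      r = + (x %ℕ k)
      q = (x /ℕ k) ℤ.* + k
      cancel : ∀ r q → r ℤ.+ q ℤ.- r ≡ q
      cancel = solve-∀

  modℤ-cong : ∀ x y → + k ℤ∣.∣ x ℤ.- y → x modℤ k ≡ y modℤ k
  modℤ-cong x y d = toℕ-injective (begin
    toℕ (x modℤ k) ≡⟨ toℕ-fromℕ< _ ⟩
    x %ℕ k         ≡⟨ bounded _ _ (n%ℕd<d x k) (n%ℕd<d y k) d′ ⟩
    y %ℕ k         ≡⟨ toℕ-fromℕ< _ ⟨
    toℕ (y modℤ k) ∎)
    where
    open ≡-Reasoning
    rearrange : ∀ x y a b → (x ℤ.- y ℤ.- (x ℤ.- a)) ℤ.+ (y ℤ.- b) ≡ a ℤ.- b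
    rearrange = solve-∀
    d′ : + k ℤ∣.∣ + (x %ℕ k) ℤ.- + (y %ℕ k)
    d′ = subst (+ k ℤ∣.∣_) (rearrange x y (+ (x %ℕ k)) (+ (y %ℕ k)))
           (ℤ∣.∣m∣n⇒∣m+n (ℤ∣.∣m∣n⇒∣m-n d (mod-diff x)) (mod-diff y))

  ι-modℤ : ∀ x → + k ℤ∣.∣ x ℤ.- ι (x modℤ k)
  ι-modℤ x = subst (λ n → + k ℤ∣.∣ x ℤ.- + n) (sym (toℕ-fromℕ< _)) (mod-diff x)

  modℤ-ι : ∀ (i : Fin k) → ι i modℤ k ≡ i
  modℤ-ι i = toℕ-injective (trans (toℕ-fromℕ< _)
    (sym (bounded _ _ (toℕ<n i) (n%ℕd<d (ι i) k) (mod-diff (ι i)))))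

  modℤ-+ˡ : ∀ x y → (ι (x modℤ k) ℤ.+ y) modℤ k ≡ (x ℤ.+ y) modℤ k
  modℤ-+ˡ x y = sym (modℤ-cong (x ℤ.+ y) (ι (x modℤ k) ℤ.+ y)
    (subst (+ k ℤ∣.∣_) (eq x y (ι (x modℤ k))) (ι-modℤ x)))
    where
    eq : ∀ x y a → x ℤ.- a ≡ x ℤ.+ y ℤ.- (a ℤ.+ y)
    eq = solve-∀

  modℤ-+ʳ : ∀ x y → (x ℤ.+ ι (y modℤ k)) modℤ k ≡ (x ℤ.+ y) modℤ k
  modℤ-+ʳ x y = sym (modℤ-cong (x ℤ.+ y) (x ℤ.+ ι (y modℤ k))
    (subst (+ k ℤ∣.∣_) (eq x y (ι (y modℤ k))) (ι-modℤ y)))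
    where
    eq : ∀ x y a → y ℤ.- a ≡ x ℤ.+ y ℤ.- (x ℤ.+ a)
    eq = solve-∀

  modℤ--ʳ : ∀ x y → (x ℤ.- ι (y modℤ k)) modℤ k ≡ (x ℤ.- y) modℤ k
  modℤ--ʳ x y = modℤ-cong (x ℤ.- ι (y modℤ k)) (x ℤ.- y)
    (subst (+ k ℤ∣.∣_) (eq x y (ι (y modℤ k))) (ι-modℤ y))
    where
    eq : ∀ x y a → y ℤ.- a ≡ x ℤ.- a ℤ.- (x ℤ.- y)
    eq = solve-∀

------------------------------------------------------------------------
-- The dihedral group of order 2k

-- rot i is r^i and ref i is r^i s. The usual assumption k ≥ 3 is not needed to
-- define the group; it holds for the order parameter 2m² used below.
data Dihedral (k : ℕ) : Set where
  rot ref : Fin k → Dihedral k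

-- Powers with an arbitrary integer exponent, read modulo k.
r^_ : ∀ {k} .{{_ : NonZero k}} → ℤ → Dihedral k
r^_ {k} z = rot (z modℤ k)

r^_·s : ∀ {k} .{{_ : NonZero k}} → ℤ → Dihedral k
r^_·s {k} z = ref (z modℤ k)

module _ {k : ℕ} .{{_ : NonZero k}} where

  infixl 7 _∙_

  -- Forced by s r^j = r^(-j) s and s² = e.
  _∙_ : Dihedral k → Dihedral k → Dihedral k
  rot i ∙ rot j = r^ (ι i ℤ.+ ι j)
  rot i ∙ ref j = r^ (ι i ℤ.+ ι j) ·s
  ref i ∙ rot j = r^ (ι i ℤ.- ι j) ·s
  ref i ∙ ref j = r^ (ι i ℤ.- ι j)

  e : Dihedral k
  e = r^ 0ℤ

  _⁻¹ : Dihedral k → Dihedral k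
  rot i ⁻¹ = r^ (ℤ.- ι i)
  ref i ⁻¹ = ref i

  private
    plus-plus : ∀ (a b c : Fin k) →
      (ι ((ι a ℤ.+ ι b) modℤ k) ℤ.+ ι c) modℤ k ≡ (ι a ℤ.+ ι ((ι b ℤ.+ ι c) modℤ k)) modℤ k
    plus-plus a b c = begin
      (ι ((ι a ℤ.+ ι b) modℤ k) ℤ.+ ι c) modℤ k ≡⟨ modℤ-+ˡ (ι a ℤ.+ ι b) (ι c) ⟩
      (ι a ℤ.+ ι b ℤ.+ ι c) modℤ k              ≡⟨ cong (_modℤ k) (eq (ι a) (ι b) (ι c)) ⟩
      (ι a ℤ.+ (ι b ℤ.+ ι c)) modℤ k            ≡⟨ modℤ-+ʳ (ι a) (ι b ℤ.+ ι c) ⟨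
      (ι a ℤ.+ ι ((ι b ℤ.+ ι c) modℤ k)) modℤ k ∎
      where
      open ≡-Reasoning
      eq : ∀ x y z → x ℤ.+ y ℤ.+ z ≡ x ℤ.+ (y ℤ.+ z)
      eq = solve-∀

    plus-minus : ∀ (a b c : Fin k) →
      (ι ((ι a ℤ.+ ι b) modℤ k) ℤ.- ι c) modℤ k ≡ (ι a ℤ.+ ι ((ι b ℤ.- ι c) modℤ k)) modℤ k
    plus-minus a b c = begin
      (ι ((ι a ℤ.+ ι b) modℤ k) ℤ.- ι c) modℤ k ≡⟨ modℤ-+ˡ (ι a ℤ.+ ι b) (ℤ.- ι c) ⟩
      (ι a ℤ.+ ι b ℤ.- ι c) modℤ k              ≡⟨ cong (_modℤ k) (eq (ι a) (ι b) (ι c)) ⟩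
      (ι a ℤ.+ (ι b ℤ.- ι c)) modℤ k            ≡⟨ modℤ-+ʳ (ι a) (ι b ℤ.- ι c) ⟨
      (ι a ℤ.+ ι ((ι b ℤ.- ι c) modℤ k)) modℤ k ∎
      where
      open ≡-Reasoning
      eq : ∀ x y z → x ℤ.+ y ℤ.- z ≡ x ℤ.+ (y ℤ.- z)
      eq = solve-∀

    minus-minus : ∀ (a b c : Fin k) →
      (ι ((ι a ℤ.- ι b) modℤ k) ℤ.- ι c) modℤ k ≡ (ι a ℤ.- ι ((ι b ℤ.+ ι c) modℤ k)) modℤ k
    minus-minus a b c = begin
      (ι ((ι a ℤ.- ι b) modℤ k) ℤ.- ι c) modℤ k ≡⟨ modℤ-+ˡ (ι a ℤ.- ι b) (ℤ.- ι c) ⟩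
      (ι a ℤ.- ι b ℤ.- ι c) modℤ k              ≡⟨ cong (_modℤ k) (eq (ι a) (ι b) (ι c)) ⟩
      (ι a ℤ.- (ι b ℤ.+ ι c)) modℤ k            ≡⟨ modℤ--ʳ (ι a) (ι b ℤ.+ ι c) ⟨
      (ι a ℤ.- ι ((ι b ℤ.+ ι c) modℤ k)) modℤ k ∎
      where
      open ≡-Reasoning
      eq : ∀ x y z → x ℤ.- y ℤ.- z ≡ x ℤ.- (y ℤ.+ z)
      eq = solve-∀

    minus-plus : ∀ (a b c : Fin k) →
      (ι ((ι a ℤ.- ι b) modℤ k) ℤ.+ ι c) modℤ k ≡ (ι a ℤ.- ι ((ι b ℤ.- ι c) modℤ k)) modℤ k
    minus-plus a b c = begin
      (ι ((ι a ℤ.- ι b) modℤ k) ℤ.+ ι c) modℤ k ≡⟨ modℤ-+ˡ (ι a ℤ.- ι b) (ι c) ⟩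
      (ι a ℤ.- ι b ℤ.+ ι c) modℤ k              ≡⟨ cong (_modℤ k) (eq (ι a) (ι b) (ι c)) ⟩
      (ι a ℤ.- (ι b ℤ.- ι c)) modℤ k            ≡⟨ modℤ--ʳ (ι a) (ι b ℤ.- ι c) ⟨
      (ι a ℤ.- ι ((ι b ℤ.- ι c) modℤ k)) modℤ k ∎
      where
      open ≡-Reasoning
      eq : ∀ x y z → x ℤ.- y ℤ.+ z ≡ x ℤ.- (y ℤ.- z)
      eq = solve-∀

    assoc : ∀ x y z → (x ∙ y) ∙ z ≡ x ∙ (y ∙ z)
    assoc (rot a) (rot b) (rot c) = cong rot (plus-plus a b c)
    assoc (rot a) (rot b) (ref c) = cong ref (plus-plus a b c)
    assoc (rot a) (ref b) (rot c) = cong ref (plus-minus a b c)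
    assoc (rot a) (ref b) (ref c) = cong rot (plus-minus a b c)
    assoc (ref a) (rot b) (rot c) = cong ref (minus-minus a b c)
    assoc (ref a) (rot b) (ref c) = cong rot (minus-minus a b c)
    assoc (ref a) (ref b) (rot c) = cong rot (minus-plus a b c)
    assoc (ref a) (ref b) (ref c) = cong ref (minus-plus a b c)

    identityˡ : ∀ x → e ∙ x ≡ x
    identityˡ (rot i) = cong rot (trans (modℤ-+ˡ 0ℤ (ι i))
      (trans (cong (_modℤ k) (ℤₚ.+-identityˡ (ι i))) (modℤ-ι i)))
    identityˡ (ref i) = cong ref (trans (modℤ-+ˡ 0ℤ (ι i))
      (trans (cong (_modℤ k) (ℤₚ.+-identityˡ (ι i))) (modℤ-ι i)))

    identityʳ : ∀ x → x ∙ e ≡ x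
    identityʳ (rot i) = cong rot (trans (modℤ-+ʳ (ι i) 0ℤ)
      (trans (cong (_modℤ k) (ℤₚ.+-identityʳ (ι i))) (modℤ-ι i)))
    identityʳ (ref i) = cong ref (trans (modℤ--ʳ (ι i) 0ℤ)
      (trans (cong (_modℤ k) (ℤₚ.+-identityʳ (ι i))) (modℤ-ι i)))

    inverseˡ : ∀ x → x ⁻¹ ∙ x ≡ e
    inverseˡ (rot i) = cong rot (trans (modℤ-+ˡ (ℤ.- ι i) (ι i))
      (cong (_modℤ k) (ℤₚ.+-inverseˡ (ι i))))
    inverseˡ (ref i) = cong (λ z → r^ z) (ℤₚ.+-inverseʳ (ι i))

    inverseʳ : ∀ x → x ∙ x ⁻¹ ≡ e
    inverseʳ (rot i) = cong rot (trans (modℤ-+ʳ (ι i) (ℤ.- ι i))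
      (cong (_modℤ k) (ℤₚ.+-inverseʳ (ι i))))
    inverseʳ (ref i) = cong (λ z → r^ z) (ℤₚ.+-inverseʳ (ι i))

  ∙-isGroup : IsGroup _≡_ _∙_ e _⁻¹
  ∙-isGroup = record
    { isMonoid = record
      { isSemigroup = record
        { isMagma = record { isEquivalence = isEquivalence ; ∙-cong = cong₂ _∙_ }
        ; assoc   = assoc
        }
      ; identity = identityˡ , identityʳ
      }
    ; inverse = inverseˡ , inverseʳ
    ; ⁻¹-cong = cong _⁻¹
    }

dihedralGroup : (k : ℕ) .{{_ : NonZero k}} → Group 0ℓ 0ℓ
dihedralGroup k = record { isGroup = ∙-isGroup {k} }

------------------------------------------------------------------------
-- Magic and semi-magic squares

Square : ∀ {a} → Set a → ℕ → Set a
Square A n = Fin n → Fin n → A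

magicConstant : ℕ → ℕ
magicConstant m = m * (m ^ 2 + 1) / 2

-- There are m² cells, so each-once also forces every entry to lie in [1,m²].
record IsMagicSquare {m : ℕ} (M : Square ℕ m) : Set where
  open RawMonoidSum +-0-rawMonoid using (sum)
  field
    each-once    : ∀ v → 1 ≤ v → v ≤ m ^ 2 → ∃! _≡_ λ ((i , j) : Fin m × Fin m) → M i j ≡ v
    row-sum      : ∀ i → sum (λ j → M i j) ≡ magicConstant m
    column-sum   : ∀ j → sum (λ i → M i j) ≡ magicConstant m
    diagonal     : sum (λ i → M i i) ≡ magicConstant m
    antidiagonal : sum (λ i → M i (opposite i)) ≡ magicConstant m

module _ {a ℓ} (Γ : Group a ℓ) where
  open Group Γ using (Carrier; _≈_; rawMonoid)
  open RawMonoidSum rawMonoid using () renaming (sum to product)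

  HasOrderingWithProduct : ∀ {n} → (Fin n → Carrier) → Carrier → Set ℓ
  HasOrderingWithProduct {n} f μ =
    Σ[ π ∈ Permutation′ n ] product (λ l → f (π ⟨$⟩ʳ l)) ≈ μ

  -- each-once makes the n² cells correspond bijectively to the elements of Γ,
  -- so Γ necessarily has order n².
  record IsSemiMagicSquare {n : ℕ} (A : Square Carrier n) (μ : Carrier) : Set (a Level.⊔ ℓ) where
    field
      each-once : ∀ g → ∃! _≡_ λ ((i , j) : Fin n × Fin n) → A i j ≈ g
      rows      : ∀ i → HasOrderingWithProduct (λ j → A i j) μ
      columns   : ∀ j → HasOrderingWithProduct (λ i → A i j) μ

------------------------------------------------------------------------
-- The square Q

instance
  2m²-nonZero : ∀ {m} .{{_ : NonZero m}} → NonZero (2 * m ^ 2)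
  2m²-nonZero {m} = m*n≢0 2 (m ^ 2) {{_}} {{m^n≢0 m 2}}

module _ {m : ℕ} .{{_ : NonZero m}} where

  next : Fin m → Fin m
  next j = (ι j ℤ.+ 1ℤ) modℤ m

  module _ (M : Square ℕ m) where

    eExp oExp tExp : Square ℤ m
    eExp i j = + 2 ℤ.* + M i j
    oExp i j = + 2 ℤ.* + M i j ℤ.+ 1ℤ
    tExp i j = ℤ.- (+ 2 ℤ.* + M i j) ℤ.+ 1ℤ

    Q¹¹ Q²² Q¹² Q²¹ : Square (Dihedral (2 * m ^ 2)) m
    Q¹¹ i j = ifEven toℕ i + toℕ j then r^ eExp i j           else r^ oExp i j
    Q²² i j = ifEven toℕ i + toℕ j then r^ eExp i (next j)    else r^ oExp i (next j)
    Q¹² i j = ifEven toℕ i + toℕ j then r^ eExp i j ·s        else r^ tExp i j ·s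
    Q²¹ i j = ifEven toℕ i + toℕ j then r^ eExp i (next j) ·s else r^ tExp i (next j) ·s

    block : Square (Square (Dihedral (2 * m ^ 2)) m) 2
    block 0F 0F = Q¹¹
    block 0F 1F = Q¹²
    block 1F 0F = Q²¹
    block 1F 1F = Q²²

    -- remQuot m sends an index u·m + i of Fin (2 * m) to (u , i).
    Q : Square (Dihedral (2 * m ^ 2)) (2 * m)
    Q x y =
      let (u , i) = remQuot m x
          (v , j) = remQuot m y
      in block u v i j

  -- The last factors have index i + c + (m - 1) ≡ i + c - 1, respectively
  -- j - c - (m - 1) ≡ j - c + 1, modulo m.
  module _ {k : ℕ} .{{_ : NonZero k}} where
    open RawMonoidSum (Group.rawMonoid (dihedralGroup k)) using () renaming (sum to product)

    ρ : Square (Dihedral k) m → Fin m → ℕ → Dihedral k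
    ρ q i c = product (λ (l : Fin m) → q i ((ι i ℤ.+ + c ℤ.+ ι l) modℤ m))

    σ : Square (Dihedral k) m → Fin m → ℕ → Dihedral k
    σ q j c = product (λ (l : Fin m) → q ((ι j ℤ.- + c ℤ.- ι l) modℤ m) j)

{-# OPTIONS --safe #-}
-- Along a row or column of a block the two kinds of entries alternate, since m
-- is even. A line of rotations with sum s of its magic-square entries therefore
-- has product r^(2s + m/2). In a line of reflections r^a s · r^b s = r^(a - b),
-- so its product is r^(2s - m/2) or the inverse of that, according to the kind
-- of its first factor. Multiplying the two gives r^(4s) or r^m.
--
-- Every element of the group occurs in Q: if the kind of the cell (i , j) of the
-- magic square does not give the wanted element in the first block, then it
-- does in the other one, whose checkerboard is offset by one column. As there
-- are as many cells as group elements, each element occurs only once.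
module Submission where

open import Defs
open import Algebra.Bundles using (Group; Monoid)
open import Data.Bool.Base using (Bool; true; false; not; if_then_else_)
open import Data.Bool.Properties using (not-involutive)
open import Data.Fin.Base using (Fin; zero; suc; toℕ; combine; remQuot; punchOut; _↑ˡ_; _↑ʳ_)
open import Data.Fin.Patterns using (0F; 1F)
open import Data.Fin.Permutation using (Permutation′; permutation; cast-id; _⟨$⟩ʳ_; inverseʳ)
  renaming (inverseˡ to inverseˡ-⟨$⟩)
open import Data.Fin.Properties
  using (any?; _≟_; punchOut-injective; injective⇒≤; remQuot-combine; toℕ<n; *↔×; +↔⊎)
open import Data.Integer.Base as ℤ using (ℤ; +_; 1ℤ; _%ℕ_; _/ℕ_)
open import Data.Integer.Divisibility.Signed as ℤ∣ using (divides)
open import Data.Integer.DivMod using (n%ℕd<d; a≡a%ℕn+[a/ℕn]*n)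
import Data.Integer.Properties as ℤₚ
open import Data.Integer.Tactic.RingSolver using (solve-∀)
open import Data.Nat.Base as ℕ using (ℕ; zero; suc; NonZero; _≤_; _<_; _+_; _*_; _^_; s≤s; z≤n)
open import Data.Nat.Divisibility using (_∣_; _∣?_; divides; >⇒∤)
open import Data.Nat.DivMod using (m*n/n≡m)
open import Data.Nat.Properties as ℕₚ using (+-0-commutativeMonoid; m^n≢0)
open import Data.Nat.Tactic.RingSolver using () renaming (solve-∀ to solveℕ-∀)
open import Data.Product using (_×_; _,_; proj₁; proj₂; ∃; ∃₂; ∃!; uncurry)
open import Data.Sum.Base using (_⊎_; inj₁; inj₂; [_,_]′)
open import Data.Vec.Functional using (Vector)
open import Function.Base using (_∘_)
open import Function.Bundles using (_↔_; Inverse; mk↔ₛ′; mk⇔; Injection)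
open import Function.Construct.Composition using (_↔-∘_)
open import Function.Construct.Symmetry using (↔-sym)
open import Function.Definitions using (Injective; StrictlySurjective)
open import Function.Properties.Inverse using (↔⇒↣)
open import Relation.Binary.PropositionalEquality
open import Relation.Nullary.Decidable using (⌊_⌋; yes; no; isYes≗does; does-⇔)
open import Relation.Nullary.Negation using (contradiction)

import Algebra.Properties.Monoid.Sum as MonoidSum
import Algebra.Properties.CommutativeMonoid.Sum as CommutativeMonoidSum

module ℕΣ = CommutativeMonoidSum +-0-commutativeMonoid

-- Parity

even : ℕ → Bool
even n = ⌊ 2 ∣? n ⌋

-- Stated with signed divisibility because the index congruences supplied by `ι-modℤ` have that
-- form.
even-cong : ∀ a b → + 2 ℤ∣.∣ + a ℤ.- + b → even a ≡ even b
even-cong a b d = trans (isYes≗does (2 ∣? a))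
  (trans (does-⇔ (mk⇔ to from) (2 ∣? a) (2 ∣? b)) (sym (isYes≗does (2 ∣? b))))
  where
  to : 2 ∣ a → 2 ∣ b
  to 2∣a = ℤ∣.∣⇒∣ᵤ (subst (+ 2 ℤ∣.∣_) (eq (+ a) (+ b)) (ℤ∣.∣m∣n⇒∣m-n (ℤ∣.∣ᵤ⇒∣ {+ 2} {+ a} 2∣a) d))
    where
    eq : ∀ x y → x ℤ.- (x ℤ.- y) ≡ y
    eq = solve-∀
  from : 2 ∣ b → 2 ∣ a
  from 2∣b = ℤ∣.∣⇒∣ᵤ (subst (+ 2 ℤ∣.∣_) (eq (+ a) (+ b)) (ℤ∣.∣m∣n⇒∣m+n d (ℤ∣.∣ᵤ⇒∣ {+ 2} {+ b} 2∣b)))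
    where
    eq : ∀ x y → x ℤ.- y ℤ.+ y ≡ x
    eq = solve-∀

even-suc : ∀ n → even (suc n) ≡ not (even n)
even-suc zero    = refl
even-suc (suc n) = begin
  even (2 + n)       ≡⟨ even-cong (2 + n) n (divides 1ℤ (eq (+ n))) ⟩
  even n             ≡⟨ not-involutive (even n) ⟨
  not (not (even n)) ≡⟨ cong not (even-suc n) ⟨
  not (even (suc n)) ∎
  where
  open ≡-Reasoning
  eq : ∀ x → + 2 ℤ.+ x ℤ.- x ≡ 1ℤ ℤ.* + 2
  eq = solve-∀

-- The parity pattern along a line, recursive in the position so that a product can be evaluated
-- factor by factor.
alternate : Bool → ℕ → Bool
alternate b zero    = b
alternate b (suc n) = alternate (not b) n

even-+ : ∀ c n → even (c + n) ≡ alternate (even c) n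
even-+ c zero    = cong even (ℕₚ.+-identityʳ c)
even-+ c (suc n) = begin
  even (c + suc n)           ≡⟨ cong even (ℕₚ.+-suc c n) ⟩
  even (suc c + n)           ≡⟨ even-+ (suc c) n ⟩
  alternate (even (suc c)) n ≡⟨ cong (λ b → alternate b n) (even-suc c) ⟩
  alternate (not (even c)) n ∎
  where open ≡-Reasoning

-- Counts the odd-kind factors, each of which contributes the `1` in an exponent `2x + 1`.
countFalse : Bool → ℕ → ℕ
countFalse b     zero    = 0
countFalse true  (suc n) = countFalse false n
countFalse false (suc n) = suc (countFalse true n)

countFalse-*2 : ∀ b h → countFalse b (h * 2) ≡ h
countFalse-*2 b     zero    = refl
countFalse-*2 true  (suc h) = cong suc (countFalse-*2 true h)
countFalse-*2 false (suc h) = cong suc (countFalse-*2 false h)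

-- `p` and `p′` are the kinds of the two cells of `Q` that carry the same magic-square entry. Being
-- opposite, they cover both kinds, so one of them is the wanted kind `b`.
opposite-parities : ∀ {a} {A : Set a} (f g : ℕ → A) {p p′ : Bool} {n n′} b → p′ ≡ not p → n′ ≡ n →
  (if p then f n else g n) ≡ (if b then f n else g n)
  ⊎ (if p′ then f n′ else g n′) ≡ (if b then f n else g n)
opposite-parities f g {true}  true  refl refl = inj₁ refl
opposite-parities f g {true}  false refl refl = inj₂ refl
opposite-parities f g {false} true  refl refl = inj₂ refl
opposite-parities f g {false} false refl refl = inj₁ refl

-- Sorts a wanted exponent by the entries that can produce it: even ones come from `rᵉ` and `rᵉs`,
-- odd ones from `rᵒ` and `rᵗs`.
even-or-odd : ∀ {p} (P : ℤ → Set p) →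
  (∀ w → P (+ 2 ℤ.* w)) → (∀ w → P (+ 2 ℤ.* w ℤ.+ 1ℤ)) → ∀ x → P x
even-or-odd P even-case odd-case x with x %ℕ 2 | n%ℕd<d x 2 | a≡a%ℕn+[a/ℕn]*n x 2
... | 0 | _ | x≡ = subst P (sym (trans x≡ (eq (x /ℕ 2)))) (even-case (x /ℕ 2))
  where
  eq : ∀ q → + 0 ℤ.+ q ℤ.* + 2 ≡ + 2 ℤ.* q
  eq = solve-∀
... | 1 | _ | x≡ = subst P (sym (trans x≡ (eq (x /ℕ 2)))) (odd-case (x /ℕ 2))
  where
  eq : ∀ q → 1ℤ ℤ.+ q ℤ.* + 2 ≡ + 2 ℤ.* q ℤ.+ 1ℤ
  eq = solve-∀
... | suc (suc _) | s≤s (s≤s ()) | _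

-- Residues are taken in `1..n` because a magic square has entries `1..m²`; hence the shift by one
-- before and after the reduction.
positive-representative : ∀ n .{{_ : NonZero n}} x → ∃ λ v → 1 ≤ v × v ≤ n × + n ℤ∣.∣ + v ℤ.- x
positive-representative n x = suc (toℕ t) , s≤s z≤n , toℕ<n t ,
  subst (+ n ℤ∣.∣_) (eq x (ι t)) (ℤ∣.∣m⇒∣-m (ι-modℤ (x ℤ.- 1ℤ)))
  where
  t = (x ℤ.- 1ℤ) modℤ n
  eq : ∀ x t → ℤ.- (x ℤ.- 1ℤ ℤ.- t) ≡ 1ℤ ℤ.+ t ℤ.- x
  eq = solve-∀

-- Counting

-- Pigeonhole: a missed value `y` could be punched out of the codomain, giving an injection from
-- `Fin (suc n)` to `Fin n`.
injective⇒strictlySurjective : ∀ {n} {f : Fin n → Fin n} →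
  Injective _≡_ _≡_ f → StrictlySurjective _≡_ f
injective⇒strictlySurjective {zero}          inj ()
injective⇒strictlySurjective {suc n} {f = f} inj y with any? (λ x → f x ≟ y)
... | yes hit = hit
... | no miss = contradiction
  (injective⇒≤ {f = λ x → punchOut (y≢f x)} (λ {a} {b} eq → inj (punchOut-injective (y≢f a) (y≢f b) eq)))
  ℕₚ.1+n≰n
  where
  y≢f : ∀ x → y ≢ f x
  y≢f x y≡fx = miss (x , sym y≡fx)

-- A section `g` of `f` is injective because `f ∘ g` is the identity. Between sets of equal finite
-- size it is then also onto, hence a two-sided inverse of `f`. The map `h` is `g` transported to
-- `Fin n`.
strictlySurjective⇒injective : ∀ {a b n} {A : Set a} {B : Set b} → A ↔ Fin n → B ↔ Fin n →
  {f : A → B} → StrictlySurjective _≡_ f → Injective _≡_ _≡_ f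
strictlySurjective⇒injective {n = n} {A} {B} A↔ B↔ {f} surj {x} {y} fx≡fy = begin
  x       ≡⟨ section-f x ⟨
  g (f x) ≡⟨ cong g fx≡fy ⟩
  g (f y) ≡⟨ section-f y ⟩
  y       ∎
  where
  open ≡-Reasoning
  module A = Inverse A↔
  module B = Inverse B↔
  g : B → A
  g b = proj₁ (surj b)
  f-g : ∀ b → f (g b) ≡ b
  f-g b = proj₂ (surj b)
  h : Fin n → Fin n
  h = A.to ∘ g ∘ B.from
  h-injective : Injective _≡_ _≡_ h
  h-injective {i} {j} eq = Injection.injective (↔⇒↣ (↔-sym B↔))
    (trans (sym (f-g _)) (trans (cong f (Injection.injective (↔⇒↣ A↔) eq)) (f-g _)))
  section-f : ∀ a → g (f a) ≡ a
  -- Surjectivity of `h` puts `a` in the image of `g`, and there `g ∘ f` is the identity.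
  section-f a with i , hi≡ ← injective⇒strictlySurjective h-injective (A.to a)
    with refl ← Injection.injective (↔⇒↣ A↔) hi≡ = cong g (f-g _)

Dihedral↔⊎ : ∀ {k} → Dihedral k ↔ (Fin k ⊎ Fin k)
Dihedral↔⊎ = mk↔ₛ′ (λ { (rot i) → inj₁ i ; (ref i) → inj₂ i }) [ rot , ref ]′
  (λ { (inj₁ _) → refl ; (inj₂ _) → refl }) (λ { (rot _) → refl ; (ref _) → refl })

-- Permutations

module _ {m : ℕ} .{{_ : NonZero m}} where

  rotate-inverse : ∀ a b → a ℤ.+ b ≡ + 0 → ∀ (l : Fin m) →
    (a ℤ.+ ι ((b ℤ.+ ι l) modℤ m)) modℤ m ≡ l
  rotate-inverse a b a+b≡0 l = begin
    (a ℤ.+ ι ((b ℤ.+ ι l) modℤ m)) modℤ m ≡⟨ modℤ-+ʳ a (b ℤ.+ ι l) ⟩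
    (a ℤ.+ (b ℤ.+ ι l)) modℤ m            ≡⟨ cong (_modℤ m) (ℤₚ.+-assoc a b (ι l)) ⟨
    (a ℤ.+ b ℤ.+ ι l) modℤ m              ≡⟨ cong (λ z → (z ℤ.+ ι l) modℤ m) a+b≡0 ⟩
    (+ 0 ℤ.+ ι l) modℤ m                  ≡⟨ cong (_modℤ m) (ℤₚ.+-identityˡ (ι l)) ⟩
    ι l modℤ m                            ≡⟨ modℤ-ι l ⟩
    l                                     ∎
    where open ≡-Reasoning

  -- For `a = i + c` this is definitionally the order in which `ρ` visits the columns.
  rotate : ℤ → Permutation′ m
  rotate a = permutation (λ l → (a ℤ.+ ι l) modℤ m) (λ l → (ℤ.- a ℤ.+ ι l) modℤ m)
    (rotate-inverse a (ℤ.- a) (ℤₚ.+-inverseʳ a)) (rotate-inverse (ℤ.- a) a (ℤₚ.+-inverseˡ a))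

  -- For `a = j - c` this is definitionally the order in which `σ` visits the rows. It runs
  -- backwards and is therefore an involution.
  reflect : ℤ → Permutation′ m
  reflect a = permutation f f involutive involutive
    where
    f : Fin m → Fin m
    f l = (a ℤ.- ι l) modℤ m
    eq : ∀ x y → x ℤ.- (x ℤ.- y) ≡ y
    eq = solve-∀
    involutive : ∀ l → f (f l) ≡ l
    involutive l = trans (modℤ--ʳ a (a ℤ.- ι l))
      (trans (cong (_modℤ m) (eq a (ι l))) (modℤ-ι l))

  rotate-next : ∀ j → rotate 1ℤ ⟨$⟩ʳ j ≡ next j
  rotate-next j = cong (_modℤ m) (ℤₚ.+-comm 1ℤ (ι j))

  -- Written as the inverse of `rotate 1ℤ`, so that `next-previous` is one of its inverse laws.
  previous : Fin m → Fin m
  previous j = (ℤ.- 1ℤ ℤ.+ ι j) modℤ m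

  next-previous : ∀ j → next (previous j) ≡ j
  next-previous j = trans (sym (rotate-next (previous j))) (inverseʳ (rotate 1ℤ))

-- Joins one cyclic order per block to an ordering of a whole line of `Q`; the blocks themselves
-- stay in place.
blockwise : ∀ {n k} → (Fin n → Permutation′ k) → Permutation′ (n * k)
blockwise {n} {k} π = ↔-sym (*↔× {n} {k})
  ↔-∘ (mk↔ₛ′ (λ (u , i) → u , (π u ⟨$⟩ʳ i)) (λ (u , i) → u , Inverse.from (π u) i)
        (λ (u , i) → cong (u ,_) (inverseʳ (π u))) (λ (u , i) → cong (u ,_) (inverseˡ-⟨$⟩ (π u)))
  ↔-∘ *↔× {n} {k})

blockwise-combine : ∀ {n k} (π : Fin n → Permutation′ k) u i →
  blockwise π ⟨$⟩ʳ combine u i ≡ combine u (π u ⟨$⟩ʳ i)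
blockwise-combine π u i = cong (λ (v , j) → combine v (π v ⟨$⟩ʳ j)) (remQuot-combine u i)

-- Products over index ranges that are split into blocks

module _ {a ℓ} (Γ : Monoid a ℓ) where
  open Monoid Γ renaming (_∙_ to _·_; refl to ≈-refl; sym to ≈-sym; trans to ≈-trans)
  open MonoidSum Γ using () renaming (sum to product)

  product-++ : ∀ n {k} (f : Vector Carrier (n + k)) →
    product f ≈ product (λ i → f (i ↑ˡ k)) · product (λ i → f (n ↑ʳ i))
  product-++ zero    f = ≈-sym (identityˡ _)
  product-++ (suc n) f = ≈-trans (∙-congˡ (product-++ n (f ∘ suc))) (≈-sym (assoc _ _ _))

  -- Regrouping by associativity that keeps the order of the factors, as a nonabelian group
  -- requires.
  product-combine : ∀ n {k} (f : Vector Carrier (n * k)) →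
    product f ≈ product (λ (u : Fin n) → product (λ (i : Fin k) → f (combine u i)))
  product-combine zero        f = ≈-refl
  product-combine (suc n) {k} f =
    ≈-trans (product-++ k f) (∙-congˡ (product-combine n (λ i → f (k ↑ʳ i))))

-- Products in the dihedral group

signed : Bool → ℤ → ℤ
signed b z = if b then z else ℤ.- z

rot-injective : ∀ {k} {i j : Fin k} → rot i ≡ rot j → i ≡ j
rot-injective refl = refl

module _ {k : ℕ} .{{_ : NonZero k}} where
  open ≡-Reasoning
  open MonoidSum (Group.monoid (dihedralGroup k)) using ()
    renaming (sum to product; sum-cong-≗ to product-cong)

  r^-cong : ∀ {x y} → + k ℤ∣.∣ x ℤ.- y → r^_ {k} x ≡ r^ y
  r^-cong {x} {y} d = cong rot (modℤ-cong x y d)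

  r^-·s-cong : ∀ {x y} → + k ℤ∣.∣ x ℤ.- y → r^_·s {k} x ≡ r^ y ·s
  r^-·s-cong {x} {y} d = cong ref (modℤ-cong x y d)

  r^-injective : ∀ x y → r^_ {k} x ≡ r^ y → + k ℤ∣.∣ x ℤ.- y
  r^-injective x y eq = subst (+ k ℤ∣.∣_) (cancel x y (ι (y modℤ k)))
    (ℤ∣.∣m∣n⇒∣m-n
      (subst (λ i → + k ℤ∣.∣ x ℤ.- ι i) (rot-injective eq) (ι-modℤ x)) (ι-modℤ y))
    where
    cancel : ∀ x y a → x ℤ.- a ℤ.- (y ℤ.- a) ≡ x ℤ.- y
    cancel = solve-∀

  r^-∙ : ∀ x y → r^_ {k} x ∙ r^ y ≡ r^ (x ℤ.+ y)
  r^-∙ x y = cong rot (trans (modℤ-+ˡ x _) (modℤ-+ʳ x y))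

  r^-·s-∙ : ∀ x y → r^_·s {k} x ∙ r^ y ·s ≡ r^ (x ℤ.- y)
  r^-·s-∙ x y = cong rot (trans (modℤ-+ˡ x _) (modℤ--ʳ x y))

  -- Absorbs two leading reflections into a rotation; the induction along a line of reflections
  -- advances by such pairs.
  r^-·s-∙-∙ : ∀ x y z → r^_·s {k} x ∙ (r^ y ·s ∙ r^ z) ≡ r^ (x ℤ.- y ℤ.+ z)
  r^-·s-∙-∙ x y z = begin
    r^ x ·s ∙ (r^ y ·s ∙ r^ z) ≡⟨ Group.assoc (dihedralGroup k) (r^ x ·s) (r^ y ·s) (r^ z) ⟨
    (r^ x ·s ∙ r^ y ·s) ∙ r^ z ≡⟨ cong (_∙ r^ z) (r^-·s-∙ x y) ⟩
    r^ (x ℤ.- y) ∙ r^ z        ≡⟨ r^-∙ (x ℤ.- y) z ⟩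
    r^ (x ℤ.- y ℤ.+ z)         ∎

  -- The branches of `Q¹¹` and `Q¹²` as functions of the magic-square entry alone. They agree with
  -- those branches definitionally, so the line lemmas below apply to `Q` directly.
  rᵉ rᵒ rᵉs rᵗs : ℕ → Dihedral k
  rᵉ  n = r^ (+ 2 ℤ.* + n)
  rᵒ  n = r^ (+ 2 ℤ.* + n ℤ.+ 1ℤ)
  rᵉs n = r^ (+ 2 ℤ.* + n) ·s
  rᵗs n = r^ (ℤ.- (+ 2 ℤ.* + n) ℤ.+ 1ℤ) ·s

  -- Exponents of rotations add, so only the sum of the entries and the number of odd-kind factors
  -- matter.
  alternatingRotations : ∀ b {n} (x : Fin n → ℕ) →
    product (λ l → if alternate b (toℕ l) then rᵉ (x l) else rᵒ (x l))
      ≡ r^ (+ 2 ℤ.* + ℕΣ.sum x ℤ.+ + countFalse b n)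
  alternatingRotations b {zero} x = refl
  alternatingRotations true {suc n} x = begin
    rᵉ x₀ ∙ _
      ≡⟨ cong (rᵉ x₀ ∙_) (alternatingRotations false (x ∘ suc)) ⟩
    rᵉ x₀ ∙ r^ (+ 2 ℤ.* + S ℤ.+ + C)
      ≡⟨ r^-∙ (+ 2 ℤ.* + x₀) _ ⟩
    r^ (+ 2 ℤ.* + x₀ ℤ.+ (+ 2 ℤ.* + S ℤ.+ + C))
      ≡⟨ cong (λ z → r^ z) (eq (+ x₀) (+ S) (+ C)) ⟩
    r^ (+ 2 ℤ.* + (x₀ + S) ℤ.+ + C) ∎
    where
    x₀ = x zero
    S  = ℕΣ.sum (x ∘ suc)
    C  = countFalse false n
    eq : ∀ x y z → + 2 ℤ.* x ℤ.+ (+ 2 ℤ.* y ℤ.+ z) ≡ + 2 ℤ.* (x ℤ.+ y) ℤ.+ z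
    eq = solve-∀
  alternatingRotations false {suc n} x = begin
    rᵒ x₀ ∙ _
      ≡⟨ cong (rᵒ x₀ ∙_) (alternatingRotations true (x ∘ suc)) ⟩
    rᵒ x₀ ∙ r^ (+ 2 ℤ.* + S ℤ.+ + C)
      ≡⟨ r^-∙ (+ 2 ℤ.* + x₀ ℤ.+ 1ℤ) _ ⟩
    r^ (+ 2 ℤ.* + x₀ ℤ.+ 1ℤ ℤ.+ (+ 2 ℤ.* + S ℤ.+ + C))
      ≡⟨ cong (λ z → r^ z) (eq (+ x₀) (+ S) (+ C)) ⟩
    r^ (+ 2 ℤ.* + (x₀ + S) ℤ.+ + suc C) ∎
    where
    x₀ = x zero
    S  = ℕΣ.sum (x ∘ suc)
    C  = countFalse true n
    eq : ∀ x y z → + 2 ℤ.* x ℤ.+ 1ℤ ℤ.+ (+ 2 ℤ.* y ℤ.+ z) ≡ + 2 ℤ.* (x ℤ.+ y) ℤ.+ (1ℤ ℤ.+ z)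
    eq = solve-∀

  -- An adjacent pair with entries `x` and `y` multiplies to `r^(2(x + y) - 1)` if the even kind
  -- comes first and to the inverse of that otherwise. The `h` pairs all start with the same kind,
  -- so one sign governs the whole line.
  alternatingReflections : ∀ b h (x : Fin (h * 2) → ℕ) →
    product (λ l → if alternate b (toℕ l) then rᵉs (x l) else rᵗs (x l))
      ≡ r^ signed b (+ 2 ℤ.* + ℕΣ.sum x ℤ.- + h)
  alternatingReflections true  zero x = refl
  alternatingReflections false zero x = refl
  alternatingReflections true (suc h) x = begin
    rᵉs x₀ ∙ (rᵗs x₁ ∙ _)
      ≡⟨ cong (λ p → rᵉs x₀ ∙ (rᵗs x₁ ∙ p)) (alternatingReflections true h (λ l → x (suc (suc l)))) ⟩
    rᵉs x₀ ∙ (rᵗs x₁ ∙ r^ (+ 2 ℤ.* + S ℤ.- + h))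
      ≡⟨ r^-·s-∙-∙ (+ 2 ℤ.* + x₀) (ℤ.- (+ 2 ℤ.* + x₁) ℤ.+ 1ℤ) _ ⟩
    r^ (+ 2 ℤ.* + x₀ ℤ.- (ℤ.- (+ 2 ℤ.* + x₁) ℤ.+ 1ℤ) ℤ.+ (+ 2 ℤ.* + S ℤ.- + h))
      ≡⟨ cong (λ z → r^ z) (eq (+ x₀) (+ x₁) (+ S) (+ h)) ⟩
    r^ (+ 2 ℤ.* + (x₀ + (x₁ + S)) ℤ.- + suc h) ∎
    where
    x₀ = x zero
    x₁ = x (suc zero)
    S  = ℕΣ.sum (λ l → x (suc (suc l)))
    eq : ∀ x y s h → + 2 ℤ.* x ℤ.- (ℤ.- (+ 2 ℤ.* y) ℤ.+ 1ℤ) ℤ.+ (+ 2 ℤ.* s ℤ.- h)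
      ≡ + 2 ℤ.* (x ℤ.+ (y ℤ.+ s)) ℤ.- (1ℤ ℤ.+ h)
    eq = solve-∀
  alternatingReflections false (suc h) x = begin
    rᵗs x₀ ∙ (rᵉs x₁ ∙ _)
      ≡⟨ cong (λ p → rᵗs x₀ ∙ (rᵉs x₁ ∙ p)) (alternatingReflections false h (λ l → x (suc (suc l)))) ⟩
    rᵗs x₀ ∙ (rᵉs x₁ ∙ r^ (ℤ.- (+ 2 ℤ.* + S ℤ.- + h)))
      ≡⟨ r^-·s-∙-∙ (ℤ.- (+ 2 ℤ.* + x₀) ℤ.+ 1ℤ) (+ 2 ℤ.* + x₁) _ ⟩
    r^ (ℤ.- (+ 2 ℤ.* + x₀) ℤ.+ 1ℤ ℤ.- + 2 ℤ.* + x₁ ℤ.+ ℤ.- (+ 2 ℤ.* + S ℤ.- + h))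
      ≡⟨ cong (λ z → r^ z) (eq (+ x₀) (+ x₁) (+ S) (+ h)) ⟩
    r^ (ℤ.- (+ 2 ℤ.* + (x₀ + (x₁ + S)) ℤ.- + suc h)) ∎
    where
    x₀ = x zero
    x₁ = x (suc zero)
    S  = ℕΣ.sum (λ l → x (suc (suc l)))
    eq : ∀ x y s h → ℤ.- (+ 2 ℤ.* x) ℤ.+ 1ℤ ℤ.- + 2 ℤ.* y ℤ.+ ℤ.- (+ 2 ℤ.* s ℤ.- h)
      ≡ ℤ.- (+ 2 ℤ.* (x ℤ.+ (y ℤ.+ s)) ℤ.- (1ℤ ℤ.+ h))
    eq = solve-∀

  -- Rows and columns at once: `v` is a line of the magic square, `π` the order of traversal, and
  -- `p l` the coordinate sum of the `l`-th visited cell. The kinds alternate, starting with the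
  -- parity of `c`, and reordering leaves the sum of `v` unchanged.
  module _ (h : ℕ) (π : Permutation′ (h * 2)) (v : Fin (h * 2) → ℕ) {s : ℕ} (Σv : ℕΣ.sum v ≡ s)
           (p : Fin (h * 2) → ℕ) (c : ℕ) (p-parity : ∀ l → even (p l) ≡ even (c + toℕ l)) where

    private
      Σvπ : ℕΣ.sum (λ l → v (π ⟨$⟩ʳ l)) ≡ s
      Σvπ = trans (sym (ℕΣ.sum-permute v π)) Σv

      alternates : (f g : ℕ → Dihedral k) →
        product (λ l → if even (p l) then f (v (π ⟨$⟩ʳ l)) else g (v (π ⟨$⟩ʳ l)))
          ≡ product (λ l → if alternate (even c) (toℕ l) then f (v (π ⟨$⟩ʳ l)) else g (v (π ⟨$⟩ʳ l)))
      alternates f g = product-cong λ l →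
        cong (if_then f (v (π ⟨$⟩ʳ l)) else g (v (π ⟨$⟩ʳ l)))
             (trans (p-parity l) (even-+ c (toℕ l)))

    rotationLine : product (λ l → if even (p l) then rᵉ (v (π ⟨$⟩ʳ l)) else rᵒ (v (π ⟨$⟩ʳ l)))
      ≡ r^ (+ 2 ℤ.* + s ℤ.+ + h)
    rotationLine = trans (alternates rᵉ rᵒ) (trans
      (alternatingRotations (even c) (λ l → v (π ⟨$⟩ʳ l)))
      (cong₂ (λ s c → r^ (+ 2 ℤ.* + s ℤ.+ + c)) Σvπ (countFalse-*2 (even c) h)))

    reflectionLine : product (λ l → if even (p l) then rᵉs (v (π ⟨$⟩ʳ l)) else rᵗs (v (π ⟨$⟩ʳ l)))
      ≡ r^ signed (even c) (+ 2 ℤ.* + s ℤ.- + h)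
    reflectionLine = trans (alternates rᵉs rᵗs) (trans
      (alternatingReflections (even c) h (λ l → v (π ⟨$⟩ʳ l)))
      (cong (λ s → r^ signed (even c) (+ 2 ℤ.* + s ℤ.- + h)) Σvπ))

  -- For `b = even c` this unfolds to the case distinction of the theorem, with `m = h * 2`.
  pairProduct : ℕ → ℕ → Bool → Dihedral k
  pairProduct h s b = if b then r^ (+ (4 * s)) else r^ (+ (h * 2))

  -- With the positive sign the two terms `h` cancel and leave `4s`; with the negative sign the
  -- terms `2s` cancel and leave `2h`.
  rotation∙reflection : ∀ h s b →
    r^ (+ 2 ℤ.* + s ℤ.+ + h) ∙ r^ signed b (+ 2 ℤ.* + s ℤ.- + h) ≡ pairProduct h s b
  rotation∙reflection h s true = trans
    (r^-∙ (+ 2 ℤ.* + s ℤ.+ + h) (+ 2 ℤ.* + s ℤ.- + h))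
    (cong (λ z → r^ z) (trans (eq (+ s) (+ h)) (sym (ℤₚ.pos-* 4 s))))
    where
    eq : ∀ s h → + 2 ℤ.* s ℤ.+ h ℤ.+ (+ 2 ℤ.* s ℤ.- h) ≡ + 4 ℤ.* s
    eq = solve-∀
  rotation∙reflection h s false = trans
    (r^-∙ (+ 2 ℤ.* + s ℤ.+ + h) (ℤ.- (+ 2 ℤ.* + s ℤ.- + h)))
    (cong (λ z → r^ z) (trans (eq (+ s) (+ h)) (sym (ℤₚ.pos-* h 2))))
    where
    eq : ∀ s h → + 2 ℤ.* s ℤ.+ h ℤ.+ ℤ.- (+ 2 ℤ.* s ℤ.- h) ≡ h ℤ.* + 2
    eq = solve-∀

  -- A whole line of reflections already multiplies to a rotation, so the two factors commute.
  reflection∙rotation : ∀ h s b →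
    r^ signed b (+ 2 ℤ.* + s ℤ.- + h) ∙ r^ (+ 2 ℤ.* + s ℤ.+ + h) ≡ pairProduct h s b
  reflection∙rotation h s b = begin
    r^ y ∙ r^ x      ≡⟨ r^-∙ y x ⟩
    r^ (y ℤ.+ x)     ≡⟨ cong (λ z → r^ z) (ℤₚ.+-comm y x) ⟩
    r^ (x ℤ.+ y)     ≡⟨ r^-∙ x y ⟨
    r^ x ∙ r^ y      ≡⟨ rotation∙reflection h s b ⟩
    pairProduct h s b   ∎
    where
    x = + 2 ℤ.* + s ℤ.+ + h
    y = signed b (+ 2 ℤ.* + s ℤ.- + h)

-- From entries modulo q to exponents modulo 2q

module _ (q : ℕ) .{{_ : NonZero (2 * q)}} {n : ℕ} {w : ℤ} where

  private
    double-∣ : ∀ {x} → + q ℤ∣.∣ x → + (2 * q) ℤ∣.∣ + 2 ℤ.* x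
    double-∣ {x} d = subst (ℤ∣._∣ + 2 ℤ.* x) (sym (ℤₚ.pos-* 2 q)) (ℤ∣.*-monoʳ-∣ (+ 2) d)

    even-∣ : + q ℤ∣.∣ + n ℤ.- w → + (2 * q) ℤ∣.∣ + 2 ℤ.* + n ℤ.- + 2 ℤ.* w
    even-∣ d = subst (+ (2 * q) ℤ∣.∣_) (eq (+ n) w) (double-∣ d)
      where
      eq : ∀ a w → + 2 ℤ.* (a ℤ.- w) ≡ + 2 ℤ.* a ℤ.- + 2 ℤ.* w
      eq = solve-∀

  rᵉ-cong : + q ℤ∣.∣ + n ℤ.- w → rᵉ {2 * q} n ≡ r^ (+ 2 ℤ.* w)
  rᵉ-cong d = r^-cong {x = + 2 ℤ.* + n} {+ 2 ℤ.* w} (even-∣ d)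

  rᵉs-cong : + q ℤ∣.∣ + n ℤ.- w → rᵉs {2 * q} n ≡ r^ (+ 2 ℤ.* w) ·s
  rᵉs-cong d = r^-·s-cong {x = + 2 ℤ.* + n} {+ 2 ℤ.* w} (even-∣ d)

  rᵒ-cong : + q ℤ∣.∣ + n ℤ.- w → rᵒ {2 * q} n ≡ r^ (+ 2 ℤ.* w ℤ.+ 1ℤ)
  rᵒ-cong d = r^-cong {x = + 2 ℤ.* + n ℤ.+ 1ℤ} {+ 2 ℤ.* w ℤ.+ 1ℤ}
    (subst (+ (2 * q) ℤ∣.∣_) (eq (+ n) w) (double-∣ d))
    where
    eq : ∀ a w → + 2 ℤ.* (a ℤ.- w) ≡ + 2 ℤ.* a ℤ.+ 1ℤ ℤ.- (+ 2 ℤ.* w ℤ.+ 1ℤ)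
    eq = solve-∀

  -- The exponent of `rᵗs` contains the entry negatively, so producing `2w + 1` takes an entry
  -- congruent to `-w`.
  rᵗs-cong : + q ℤ∣.∣ + n ℤ.- (ℤ.- w) → rᵗs {2 * q} n ≡ r^ (+ 2 ℤ.* w ℤ.+ 1ℤ) ·s
  rᵗs-cong d = r^-·s-cong {x = ℤ.- (+ 2 ℤ.* + n) ℤ.+ 1ℤ} {+ 2 ℤ.* w ℤ.+ 1ℤ}
    (subst (+ (2 * q) ℤ∣.∣_) (eq (+ n) w) (ℤ∣.∣m⇒∣-m (double-∣ d)))
    where
    eq : ∀ a w → ℤ.- (+ 2 ℤ.* (a ℤ.- ℤ.- w)) ≡ ℤ.- (+ 2 ℤ.* a) ℤ.+ 1ℤ ℤ.- (+ 2 ℤ.* w ℤ.+ 1ℤ)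
    eq = solve-∀

-- The square Q

-- Only the blocks of reflections are traversed with a shift.
offset : Fin 2 → Fin 2 → ℕ → ℕ
offset 0F 0F c = 0
offset 0F 1F c = c
offset 1F 0F c = c
offset 1F 1F c = 0

module _ (h : ℕ) .{{_ : NonZero (h * 2)}} where
  open ≡-Reasoning

  private
    m = h * 2
    2∣m : + 2 ℤ∣.∣ + m
    2∣m = divides (+ h) (ℤₚ.pos-* h 2)

  -- The visited column is `j ≡ i + c + l` modulo `m`, hence modulo 2 since `m` is even, and
  -- `i + j ≡ 2i + c + l`. The alternation thus survives the wrap-around.
  rotate-parity : ∀ (i : Fin m) c l →
    even (toℕ i + toℕ (rotate (ι i ℤ.+ + c) ⟨$⟩ʳ l)) ≡ even (c + toℕ l)
  rotate-parity i c l = even-cong (toℕ i + toℕ j) (c + toℕ l)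
    (subst (+ 2 ℤ∣.∣_) (eq (ι i) (+ c) (ι l) (ι j))
      (ℤ∣.∣m∣n⇒∣m-n (divides (ι i) refl)
        (ℤ∣.∣-trans 2∣m (ι-modℤ (ι i ℤ.+ + c ℤ.+ ι l)))))
    where
    j = rotate (ι i ℤ.+ + c) ⟨$⟩ʳ l
    eq : ∀ i c l j → i ℤ.* + 2 ℤ.- (i ℤ.+ c ℤ.+ l ℤ.- j) ≡ i ℤ.+ j ℤ.- (c ℤ.+ l)
    eq = solve-∀

  -- Here the visited row is `i ≡ j - c - l`, so `i + j ≡ 2i + c + l` modulo 2.
  reflect-parity : ∀ (j : Fin m) c l →
    even (toℕ (reflect (ι j ℤ.- + c) ⟨$⟩ʳ l) + toℕ j) ≡ even (c + toℕ l)
  reflect-parity j c l = even-cong (toℕ i + toℕ j) (c + toℕ l)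
    (subst (+ 2 ℤ∣.∣_) (eq (ι j) (+ c) (ι l) (ι i))
      (ℤ∣.∣m∣n⇒∣m+n (divides (ι i) refl)
        (ℤ∣.∣-trans 2∣m (ι-modℤ (ι j ℤ.- + c ℤ.- ι l)))))
    where
    i = reflect (ι j ℤ.- + c) ⟨$⟩ʳ l
    eq : ∀ j c l i → i ℤ.* + 2 ℤ.+ (j ℤ.- c ℤ.- l ℤ.- i) ≡ i ℤ.+ j ℤ.- (c ℤ.+ l)
    eq = solve-∀

  previous-parity : ∀ i (j : Fin m) → even (i + toℕ (previous j)) ≡ not (even (i + toℕ j))
  previous-parity i j = begin
    even (i + toℕ j′)     ≡⟨ even-cong (i + toℕ j′) (suc (i + toℕ j))
      (subst (+ 2 ℤ∣.∣_) (eq (+ i) (ι j) (ι j′))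
        (ℤ∣.∣m∣n⇒∣m-n (divides (ℤ.- 1ℤ) refl) (ℤ∣.∣-trans 2∣m (ι-modℤ (ℤ.- 1ℤ ℤ.+ ι j))))) ⟩
    even (suc (i + toℕ j)) ≡⟨ even-suc (i + toℕ j) ⟩
    not (even (i + toℕ j)) ∎
    where
    j′ = previous j
    eq : ∀ i j j′ → ℤ.- 1ℤ ℤ.* + 2 ℤ.- (ℤ.- 1ℤ ℤ.+ j ℤ.- j′) ≡ i ℤ.+ j′ ℤ.- (1ℤ ℤ.+ (i ℤ.+ j))
    eq = solve-∀

  module _ (M : Square ℕ m) {s : ℕ} where

    private
      K = 2 * m ^ 2
      rotations : Dihedral K
      rotations = r^ (+ 2 ℤ.* + s ℤ.+ + h)
      reflections : ℕ → Dihedral K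
      reflections c = r^ signed (even c) (+ 2 ℤ.* + s ℤ.- + h)
      -- `Q²²` and `Q²¹` of `M` are definitionally `Q¹¹` and `Q¹²` of this square, so the lower
      -- blocks reuse the lemmas for the upper ones.
      shiftedM : Square ℕ m
      shiftedM i j = M i (next j)

      module _ (N : Square ℕ m) where
        rowʳ : ∀ i → ℕΣ.sum (N i) ≡ s → ∀ c → ρ (Q¹¹ N) i c ≡ rotations
        rowʳ i Σ≡ c = rotationLine h (rotate (ι i ℤ.+ + c)) (N i) Σ≡ _ c (rotate-parity i c)
        rowˢ : ∀ i → ℕΣ.sum (N i) ≡ s → ∀ c → ρ (Q¹² N) i c ≡ reflections c
        rowˢ i Σ≡ c = reflectionLine h (rotate (ι i ℤ.+ + c)) (N i) Σ≡ _ c (rotate-parity i c)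
        columnʳ : ∀ j → ℕΣ.sum (λ i → N i j) ≡ s → ∀ c → σ (Q¹¹ N) j c ≡ rotations
        columnʳ j Σ≡ c =
          rotationLine h (reflect (ι j ℤ.- + c)) (λ i → N i j) Σ≡ _ c (reflect-parity j c)
        columnˢ : ∀ j → ℕΣ.sum (λ i → N i j) ≡ s → ∀ c → σ (Q¹² N) j c ≡ reflections c
        columnˢ j Σ≡ c =
          reflectionLine h (reflect (ι j ℤ.- + c)) (λ i → N i j) Σ≡ _ c (reflect-parity j c)

    rowProduct : (∀ i → ℕΣ.sum (M i) ≡ s) → ∀ u i c →
      ρ (block M u 0F) i (offset u 0F c) ∙ ρ (block M u 1F) i (offset u 1F c) ≡ pairProduct h s (even c)
    rowProduct rows 0F i c = trans (cong₂ _∙_ (rowʳ M i (rows i) 0) (rowˢ M i (rows i) c))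
      (rotation∙reflection h s (even c))
    rowProduct rows 1F i c = trans (cong₂ _∙_ (rowˢ shiftedM i shifted c) (rowʳ shiftedM i shifted 0))
      (reflection∙rotation h s (even c))
      where
      -- The shifted row is a cyclic rearrangement of row `i`.
      shifted : ℕΣ.sum (shiftedM i) ≡ s
      shifted = trans (sym (trans (ℕΣ.sum-permute (M i) (rotate 1ℤ))
        (ℕΣ.sum-cong-≗ (λ j → cong (M i) (rotate-next j))))) (rows i)

    columnProduct : (∀ j → ℕΣ.sum (λ i → M i j) ≡ s) → ∀ v j c →
      σ (block M 0F v) j (offset v 0F c) ∙ σ (block M 1F v) j (offset v 1F c) ≡ pairProduct h s (even c)
    columnProduct columns 0F j c =
      -- Shifting turns column `j` into the whole column `next j`, whose sum is again `s`.
      trans (cong₂ _∙_ (columnʳ M j (columns j) 0) (columnˢ shiftedM j (columns (next j)) c))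
        (rotation∙reflection h s (even c))
    columnProduct columns 1F j c =
      trans (cong₂ _∙_ (columnˢ M j (columns j) c) (columnʳ shiftedM j (columns (next j)) 0))
        (reflection∙rotation h s (even c))

  -- Each group element exactly once in `Q`

  module _ (M : Square ℕ m) where

    private
      K = 2 * m ^ 2
      D = dihedralGroup K
    open MonoidSum (Group.monoid D) using () renaming (sum to product; sum-cong-≗ to product-cong)

    Q-combine : ∀ u i v j → Q M (combine u i) (combine v j) ≡ block M u v i j
    Q-combine u i v j = cong₂ (λ (u , i) (v , j) → block M u v i j)
      (remQuot-combine u i) (remQuot-combine v j)

    Occurs : Dihedral K → Set
    Occurs g = ∃ λ ((x , y) : Fin (2 * m) × Fin (2 * m)) → Q M x y ≡ g

    block-entry-occurs : ∀ u i v j {g} → block M u v i j ≡ g → Occurs g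
    block-entry-occurs u i v j eq = (combine u i , combine v j) , trans (Q-combine u i v j) eq

    -- `Q¹¹` uses the entry `M i j` at column `j`, and `Q²²` uses it at column `previous j`, where
    -- `next` leads back to `j`.
    rotations-occur : ∀ i j b → Occurs (if b then rᵉ (M i j) else rᵒ (M i j))
    rotations-occur i j b =
      [ block-entry-occurs 0F i 0F j , block-entry-occurs 1F i 1F (previous j) ]′
      (opposite-parities rᵉ rᵒ b (previous-parity (toℕ i) j) (cong (M i) (next-previous j)))

    reflections-occur : ∀ i j b → Occurs (if b then rᵉs (M i j) else rᵗs (M i j))
    reflections-occur i j b =
      [ block-entry-occurs 0F i 1F j , block-entry-occurs 1F i 0F (previous j) ]′
      (opposite-parities rᵉs rᵗs b (previous-parity (toℕ i) j) (cong (M i) (next-previous j)))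

    module _ (complete : ∀ v → 1 ≤ v → v ≤ m ^ 2 → ∃₂ λ i j → M i j ≡ v) where

      -- The entries `1..m²` form a complete residue system modulo `m²`.
      cell-mod : ∀ x → ∃₂ λ i j → + (m ^ 2) ℤ∣.∣ + M i j ℤ.- x
      cell-mod x =
        let v , 1≤v , v≤m² , d = positive-representative (m ^ 2) {{m^n≢0 m 2}} x
            i , j , Mij≡v = complete v 1≤v v≤m²
        in i , j , subst (λ v → + (m ^ 2) ℤ∣.∣ + v ℤ.- x) (sym Mij≡v) d

      r^-occurs : ∀ x → Occurs (r^ x)
      r^-occurs = even-or-odd _
        (λ w → let i , j , d = cell-mod w in
          subst Occurs (rᵉ-cong (m ^ 2) {M i j} {w} d) (rotations-occur i j true))
        (λ w → let i , j , d = cell-mod w in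
          subst Occurs (rᵒ-cong (m ^ 2) {M i j} {w} d) (rotations-occur i j false))

      r^-·s-occurs : ∀ x → Occurs (r^ x ·s)
      r^-·s-occurs = even-or-odd _
        (λ w → let i , j , d = cell-mod w in
          subst Occurs (rᵉs-cong (m ^ 2) {M i j} {w} d) (reflections-occur i j true))
        (λ w → let i , j , d = cell-mod (ℤ.- w) in
          subst Occurs (rᵗs-cong (m ^ 2) {M i j} {w} d) (reflections-occur i j false))

      Q-surjective : StrictlySurjective _≡_ (uncurry (Q M))
      Q-surjective (rot z) = subst Occurs (cong rot (modℤ-ι z)) (r^-occurs (ι z))
      Q-surjective (ref z) = subst Occurs (cong ref (modℤ-ι z)) (r^-·s-occurs (ι z))

      Q-injective : Injective _≡_ _≡_ (uncurry (Q M))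
      Q-injective = strictlySurjective⇒injective
        -- There are `(2m)²` cells and `K + K` group elements with `K = 2m²`; `eq` identifies the
        -- two counts, spelling `m ^ 2` as it unfolds.
        (cast-id (eq m) ↔-∘ ↔-sym *↔×) (↔-sym (+↔⊎ {K} {K}) ↔-∘ Dihedral↔⊎) Q-surjective
        where
        eq : ∀ m → (2 * m) * (2 * m) ≡ 2 * (m * (m * 1)) + 2 * (m * (m * 1))
        eq = solveℕ-∀

      Q-each-once : ∀ g → ∃! _≡_ λ ((x , y) : Fin (2 * m) × Fin (2 * m)) → Q M x y ≡ g
      Q-each-once g =
        let xy , eq = Q-surjective g in xy , eq , λ eq′ → Q-injective (trans eq (sym eq′))

    -- Orderings of the full rows and columns of `Q`

    product-blockwise : (π : Fin 2 → Permutation′ m) (f : Fin (2 * m) → Dihedral K) →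
      product (λ l → f (blockwise {2} {m} π ⟨$⟩ʳ l))
        ≡ product (λ l → f (combine {2} {m} 0F (π 0F ⟨$⟩ʳ l)))
          ∙ product (λ l → f (combine {2} {m} 1F (π 1F ⟨$⟩ʳ l)))
    product-blockwise π f = begin
      product (λ l → f (blockwise {2} {m} π ⟨$⟩ʳ l))
        ≡⟨ product-combine (Group.monoid D) 2 {m} (λ l → f (blockwise {2} {m} π ⟨$⟩ʳ l)) ⟩
      half′ 0F ∙ (half′ 1F ∙ e)               ≡⟨ cong (half′ 0F ∙_) (Group.identityʳ D (half′ 1F)) ⟩
      half′ 0F ∙ half′ 1F                     ≡⟨ cong₂ _∙_ (half≡ 0F) (half≡ 1F) ⟩
      half 0F ∙ half 1F                       ∎
      where
      half half′ : Fin 2 → Dihedral K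
      half  u = product (λ l → f (combine {2} {m} u (π u ⟨$⟩ʳ l)))
      half′ u = product (λ l → f (blockwise {2} {m} π ⟨$⟩ʳ combine {2} {m} u l))
      half≡ : ∀ u → half′ u ≡ half u
      half≡ u = product-cong (λ l → cong f (blockwise-combine {2} {m} π u l))

    module _ (magic : IsMagicSquare M) where
      open IsMagicSquare magic

      -- One shift `c` serves all lines: reflection blocks are traversed with shift `c`, rotation
      -- blocks with shift 0. The parity of `c` alone selects the constant.
      Q-isSemiMagic : ∀ c → IsSemiMagicSquare D (Q M) (pairProduct h (magicConstant m) (even c))
      Q-isSemiMagic c = record
        { each-once = Q-each-once λ v 1≤v v≤m² →
            let ((i , j) , eq , _) = each-once v 1≤v v≤m² in i , j , eq
        ; rows = λ x →
            let u = proj₁ (remQuot {2} m x)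
                i = proj₂ (remQuot {2} m x)
                π : Fin 2 → Permutation′ m
                π = λ v → rotate (ι i ℤ.+ + offset u v c)
            in blockwise {2} {m} π , trans (product-blockwise π (Q M x)) (trans
                 -- `Q` already splits `x` into `u` and `i`; it remains to simplify the split of the
                 -- combined column index.
                 (cong₂ _∙_
                   (product-cong λ l → cong (λ (v , j) → block M u v i j)
                     (remQuot-combine {2} {m} 0F (π 0F ⟨$⟩ʳ l)))
                   (product-cong λ l → cong (λ (v , j) → block M u v i j)
                     (remQuot-combine {2} {m} 1F (π 1F ⟨$⟩ʳ l))))
                 (rowProduct M row-sum u i c))
        ; columns = λ y →
            let v = proj₁ (remQuot {2} m y)
                j = proj₂ (remQuot {2} m y)
                π : Fin 2 → Permutation′ m
                π = λ u → reflect (ι j ℤ.- + offset v u c)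
            in blockwise {2} {m} π , trans (product-blockwise π (λ x → Q M x y)) (trans
                 (cong₂ _∙_
                   (product-cong λ l → cong (λ (u , i) → block M u v i j)
                     (remQuot-combine {2} {m} 0F (π 0F ⟨$⟩ʳ l)))
                   (product-cong λ l → cong (λ (u , i) → block M u v i j)
                     (remQuot-combine {2} {m} 1F (π 1F ⟨$⟩ʳ l))))
                 (columnProduct M column-sum v j c))
        }

  -- Distinctness of the two constants

  -- Equality would make `2m²` divide `4μ - m`, where `4μ = 2m³ + 2m`. Subtracting `m = 2h` copies
  -- of `2m²` leaves `m`, so `2m²` would divide the smaller positive number `m`.
  magicConstants-distinct : r^_ {2 * m ^ 2} (+ (4 * magicConstant m)) ≢ r^ (+ m)
  magicConstants-distinct eq = contradiction 2m²∣m (>⇒∤ m<2m²)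
    where
    q = m ^ 2
    2m²∣m : 2 * q ∣ m
    2m²∣m = ℤ∣.∣⇒∣ᵤ (subst (+ (2 * q) ℤ∣.∣_) difference
      (ℤ∣.∣m∣n⇒∣m-n (r^-injective (+ (4 * magicConstant m)) (+ m) eq)
        (ℤ∣.∣n⇒∣m*n (+ 2 ℤ.* + h) ℤ∣.∣-refl)))
      where
      -- The halving in `magicConstant` is exact because `m = h * 2`.
      μ≡ : magicConstant m ≡ h * (q + 1)
      μ≡ = trans (cong (ℕ._/ 2) (eq′ h (q + 1))) (m*n/n≡m (h * (q + 1)) 2)
        where
        eq′ : ∀ h n → h * 2 * n ≡ h * n * 2
        eq′ = solveℕ-∀
      difference : + (4 * magicConstant m) ℤ.- + m ℤ.- (+ 2 ℤ.* + h) ℤ.* + (2 * q) ≡ + m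
      difference = begin
        + (4 * magicConstant m) ℤ.- + m ℤ.- (+ 2 ℤ.* + h) ℤ.* + (2 * q)
          ≡⟨ cong₂ (λ a b → a ℤ.- b ℤ.- (+ 2 ℤ.* + h) ℤ.* + (2 * q)) 4μ≡ (ℤₚ.pos-* h 2) ⟩
        + 4 ℤ.* (+ h ℤ.* (+ q ℤ.+ 1ℤ)) ℤ.- + h ℤ.* + 2 ℤ.- (+ 2 ℤ.* + h) ℤ.* + (2 * q)
          ≡⟨ cong (λ a → + 4 ℤ.* (+ h ℤ.* (+ q ℤ.+ 1ℤ)) ℤ.- + h ℤ.* + 2 ℤ.- (+ 2 ℤ.* + h) ℤ.* a)
               (ℤₚ.pos-* 2 q) ⟩
        + 4 ℤ.* (+ h ℤ.* (+ q ℤ.+ 1ℤ)) ℤ.- + h ℤ.* + 2 ℤ.- (+ 2 ℤ.* + h) ℤ.* (+ 2 ℤ.* + q)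
          ≡⟨ expand (+ h) (+ q) ⟩
        + h ℤ.* + 2 ≡⟨ ℤₚ.pos-* h 2 ⟨
        + m ∎
        where
        4μ≡ : + (4 * magicConstant m) ≡ + 4 ℤ.* (+ h ℤ.* (+ q ℤ.+ 1ℤ))
        4μ≡ = trans (cong (λ μ → + (4 * μ)) μ≡)
          (trans (ℤₚ.pos-* 4 (h * (q + 1))) (cong (+ 4 ℤ.*_) (ℤₚ.pos-* h (q + 1))))
        expand : ∀ h q →
          + 4 ℤ.* (h ℤ.* (q ℤ.+ 1ℤ)) ℤ.- h ℤ.* + 2 ℤ.- (+ 2 ℤ.* h) ℤ.* (+ 2 ℤ.* q) ≡ h ℤ.* + 2
        expand = solve-∀
    m<2m² : m < 2 * q
    m<2m² = ℕₚ.≤-<-trans (ℕₚ.m≤m*n m (m * 1) {{ℕₚ.m*n≢0 m 1}})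
      (subst (q <_) (ℕₚ.*-comm q 2) (ℕₚ.m<m*n q 2 {{m^n≢0 m 2}} (s≤s (s≤s z≤n))))

mainTheorem2 :
    (m : ℕ) .{{_ : NonZero m}} → 4 ≤ m → 2 ∣ m →
    (M : Square ℕ m) → IsMagicSquare M →
    let D  = dihedralGroup (2 * m ^ 2)
        μ₁ : Dihedral (2 * m ^ 2)
        μ₁ = r^ (+ (4 * magicConstant m))
        μ₂ : Dihedral (2 * m ^ 2)
        μ₂ = r^ (+ m)
    in
      ((i c : Fin m) →
        ρ (Q¹¹ M) i 0 ∙ ρ (Q¹² M) i (toℕ c) ≡ ρ (Q²¹ M) i (toℕ c) ∙ ρ (Q²² M) i 0
        × ρ (Q²¹ M) i (toℕ c) ∙ ρ (Q²² M) i 0 ≡ (ifEven toℕ c then μ₁ else μ₂))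
    × ((j c : Fin m) →
        σ (Q¹¹ M) j 0 ∙ σ (Q²¹ M) j (toℕ c) ≡ σ (Q¹² M) j (toℕ c) ∙ σ (Q²² M) j 0
        × σ (Q¹² M) j (toℕ c) ∙ σ (Q²² M) j 0 ≡ (ifEven toℕ c then μ₁ else μ₂))
    × IsSemiMagicSquare D (Q M) μ₁
    × IsSemiMagicSquare D (Q M) μ₂
    × μ₁ ≢ μ₂
-- Matching on `refl` makes `m` literally `h * 2`, the form in which the reflections of a line pair
-- up.
mainTheorem2 _ _ (divides h refl) M magic =
    (λ i c → let row₀ = rowProduct h M row-sum 0F i (toℕ c)
                 row₁ = rowProduct h M row-sum 1F i (toℕ c)
             in trans row₀ (sym row₁) , row₁)
  , (λ j c → let column₀ = columnProduct h M column-sum 0F j (toℕ c)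
                 column₁ = columnProduct h M column-sum 1F j (toℕ c)
             in trans column₀ (sym column₁) , column₁)
  -- The shifts 0 and 1 represent the two parities, and `pairProduct` reduces to the respective
  -- constant.
  , Q-isSemiMagic h M magic 0
  , Q-isSemiMagic h M magic 1
  , magicConstants-distinct h
  where open IsMagicSquare magic
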